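{- Let $\sigma=\{E,\mathsf{orange},\mathsf{blue}\}$ with $E$ a binary and $\mathsf{orange},\mathsf{blue}$ unary relation symbols, and let $$\varphi(x):=\exists y\,\Big(\mathsf{orange}(y)\wedge\neg\exists z\,\big(E(x,z)\wedge E(z,y)\big)\wedge\neg\exists z\,\big(\mathsf{blue}(z)\wedge E(y,z)\big)\Big),$$ a first-order formula of quantifier rank $2$. Then $\varphi(x)$ is not equivalent (over finite $\sigma$-structures) to any formula $\varphi'(x)$ that is a Boolean combination of local first-order formulas of quantifier rank at most $2$ and of basic local sentences.
   Context: All structures are finite with non-empty universe. The Gaifman graph of a $\sigma$-structure $\mathcal A$ has as vertices the elements of the universe $A$ and an edge between distinct $a,b$ iff both occur in a common tuple of some relation of $\mathcal A$; $\mathrm{dist}^{\mathcal A}$ is the distance in this graph ($\infty$ if disconnected). For a non-empty tuple $\bar a$, $\mathcal N_r^{\mathcal A}(\bar a)$ is the induced substructure on the set of all elements at distance at most $r$ from some entry of $\bar a$. A first-order formula $\psi$ is $r$-local if for some non-empty tuple $\bar x$ of variables containing all free variables of $\psi$, all structures $\mathcal A$ and all $\bar a\in A^{|\bar x|}$: $\mathcal A\models\psi(\bar a)\iff\mathcal N_r^{\mathcal A}(\bar a)\models\psi(\bar a)$. It is local if it is $r$-local for some $r\in\mathbb N$. For $m\in\mathbb N$, $\mathrm{dist}(x,y)>m$ denotes a first-order formula expressing that the distance of $x$ and $y$ is greater than $m$. A basic local sentence is a first-order sentence of the form $\exists y_1\cdots\exists y_\ell\big(\bigwedge_{1\le i<j\le\ell}\mathrm{dist}(y_i,y_j)>2r\wedge\bigwedge_{1\le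 j\le\ell}\lambda(y_j)\big)$ with $\ell\ge1$, $r\ge0$, and $\lambda(y)$ an $r$-local first-order formula (of arbitrary quantifier rank) with only one free variable. The quantifier rank is the maximum nesting depth of quantifiers. -}

module Defs where

open import Data.Bool using (Bool; true)
open import Data.Fin using (Fin; zero; suc; lift; _<?_)
open import Data.Irrelevant using ([_])
open import Data.List as List using (List)
open import Data.Nat using (ℕ; zero; suc; _*_; _≤_; _⊔_)
open import Data.Product using (Σ; Σ-syntax; ∃-syntax; _×_; _,_)
open import Data.Refinement using (Refinement; value; _,_)
open import Data.Sum using (_⊎_)
open import Data.Vec as Vec using (Vec; []; _∷_)
open import Data.Vec.Functional as Vector using (Vector)
open import Data.Vec.Membership.Propositional using (_∈_)
open import Function using (_∘_; _⇔_; _↔_)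
open import Relation.Binary.PropositionalEquality using (_≡_; _≢_; refl)
open import Relation.Nullary using (¬_)

infix  8 _≐_
infix  7 ¬′_
infixr 6 _∧′_
infixr 5 _∨′_

record Signature : Set₁ where
  field
    Symbol : Set
    arity  : Symbol → ℕ

open Signature public

-- Finiteness and non-emptiness are the separate predicate Finite, so that the
-- induced substructures below can be formed without deciding distances.
-- Bool-valued relations make satisfaction over finite structures decidable, so
-- it agrees with classical satisfaction.
record Structure (S : Signature) : Set₁ where
  field
    Universe : Set
    holds    : (R : Symbol S) → Vec Universe (arity S R) → Bool

open Structure public

Finite : ∀ {S} → Structure S → Set
Finite A = ∃[ n ] (Universe A ↔ Fin (suc n))

module _ {S : Signature} (A : Structure S) where

  GaifmanEdge : Universe A → Universe A → Set
  GaifmanEdge a b = a ≢ b ×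
    (∃[ R ] Σ[ t ∈ Vec (Universe A) (arity S R) ] (holds A R t ≡ true × a ∈ t × b ∈ t))

  -- Dist≤ m a b: the Gaifman graph has a walk of length at most m from a to b.
  data Dist≤ : ℕ → Universe A → Universe A → Set where
    stop : ∀ {m a} → Dist≤ m a a
    step : ∀ {m a b c} → GaifmanEdge a b → Dist≤ m b c → Dist≤ (suc m) a c

  InBall : ∀ {k} → ℕ → Vector (Universe A) k → Universe A → Set
  InBall r ā b = ∃[ i ] Dist≤ r (ā i) b

  -- Membership proofs are irrelevant, so equality in 𝒩 is equality in A.
  𝒩 : ∀ {k} → ℕ → Vector (Universe A) k → Structure S
  𝒩 r ā .Universe  = Refinement (Universe A) (InBall r ā)
  𝒩 r ā .holds R t = holds A R (Vec.map value t)

  centre : ∀ {k} r (ā : Vector (Universe A) k) → Vector (Universe (𝒩 r ā)) k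
  centre r ā i = ā i , [ (i , stop) ]

-- Well-scoped de Bruijn syntax: the free variables of a Formula S n are among
-- n variables, and a quantifier binds index zero.
data Formula (S : Signature) : ℕ → Set where
  _≐_  : ∀ {n} → Fin n → Fin n → Formula S n
  rel  : ∀ {n} (R : Symbol S) → Vec (Fin n) (arity S R) → Formula S n
  ¬′_  : ∀ {n} → Formula S n → Formula S n
  _∧′_ : ∀ {n} → Formula S n → Formula S n → Formula S n
  _∨′_ : ∀ {n} → Formula S n → Formula S n → Formula S n
  ∃′   : ∀ {n} → Formula S (suc n) → Formula S n
  ∀′   : ∀ {n} → Formula S (suc n) → Formula S n

module _ {S : Signature} where

  infix 4 _⊨_[_] _≋_ _isFreeIn_

  _⊨_[_] : ∀ {n} (A : Structure S) → Formula S n → Vector (Universe A) n → Set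
  A ⊨ i ≐ j [ α ]    = α i ≡ α j
  A ⊨ rel R t [ α ]  = holds A R (Vec.map α t) ≡ true
  A ⊨ ¬′ ψ [ α ]     = ¬ (A ⊨ ψ [ α ])
  A ⊨ ψ ∧′ χ [ α ]   = (A ⊨ ψ [ α ]) × (A ⊨ χ [ α ])
  A ⊨ ψ ∨′ χ [ α ]   = (A ⊨ ψ [ α ]) ⊎ (A ⊨ χ [ α ])
  A ⊨ ∃′ ψ [ α ]     = ∃[ a ] (A ⊨ ψ [ a Vector.∷ α ])
  A ⊨ ∀′ ψ [ α ]     = ∀ a → A ⊨ ψ [ a Vector.∷ α ]

  qr : ∀ {n} → Formula S n → ℕ
  qr (i ≐ j)   = 0
  qr (rel R t) = 0
  qr (¬′ ψ)    = qr ψ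
  qr (ψ ∧′ χ)  = qr ψ ⊔ qr χ
  qr (ψ ∨′ χ)  = qr ψ ⊔ qr χ
  qr (∃′ ψ)    = suc (qr ψ)
  qr (∀′ ψ)    = suc (qr ψ)

  _isFreeIn_ : ∀ {n} → Fin n → Formula S n → Set
  v isFreeIn (i ≐ j)   = v ≡ i ⊎ v ≡ j
  v isFreeIn (rel R t) = v ∈ t
  v isFreeIn (¬′ ψ)    = v isFreeIn ψ
  v isFreeIn (ψ ∧′ χ)  = v isFreeIn ψ ⊎ v isFreeIn χ
  v isFreeIn (ψ ∨′ χ)  = v isFreeIn ψ ⊎ v isFreeIn χ
  v isFreeIn (∃′ ψ)    = suc v isFreeIn ψ
  v isFreeIn (∀′ ψ)    = suc v isFreeIn ψ

  rename : ∀ {m n} → (Fin m → Fin n) → Formula S m → Formula S n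
  rename ρ (i ≐ j)   = ρ i ≐ ρ j
  rename ρ (rel R t) = rel R (Vec.map ρ t)
  rename ρ (¬′ ψ)    = ¬′ rename ρ ψ
  rename ρ (ψ ∧′ χ)  = rename ρ ψ ∧′ rename ρ χ
  rename ρ (ψ ∨′ χ)  = rename ρ ψ ∨′ rename ρ χ
  rename ρ (∃′ ψ)    = ∃′ (rename (lift 1 ρ) ψ)
  rename ρ (∀′ ψ)    = ∀′ (rename (lift 1 ρ) ψ)

  _≋_ : ∀ {n} → Formula S n → Formula S n → Set₁
  ψ ≋ χ = ∀ (A : Structure S) → Finite A → ∀ α → (A ⊨ ψ [ α ]) ⇔ (A ⊨ χ [ α ])

  -- The tuple x̄ has length suc k and may contain variables outside the scope
  -- of ψ; ρ gives the position in x̄ of each free variable of ψ, and its values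
  -- on variables that are not free in ψ play no role.
  LocalWithRadius : ∀ {n} → ℕ → Formula S n → Set₁
  LocalWithRadius {n} r ψ =
    ∃[ k ] Σ[ ρ ∈ (Fin n → Fin (suc k)) ]
      (∀ {v w} → v isFreeIn ψ → w isFreeIn ψ → ρ v ≡ ρ w → v ≡ w) ×
      (∀ (A : Structure S) → Finite A → (ā : Vector (Universe A) (suc k)) →
        (A ⊨ ψ [ ā ∘ ρ ]) ⇔ (𝒩 A r ā ⊨ ψ [ centre A r ā ∘ ρ ]))

  Local : ∀ {n} → Formula S n → Set₁
  Local ψ = ∃[ r ] LocalWithRadius r ψ

  ExpressesDist> : ℕ → Formula S 2 → Set₁
  ExpressesDist> m δ = ∀ (A : Structure S) → Finite A → ∀ a b →
    (A ⊨ δ [ a Vector.∷ b Vector.∷ Vector.[] ]) ⇔ (¬ Dist≤ A m a b)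

  ∃* : ∀ ℓ → Formula S ℓ → Formula S 0
  ∃* zero    ψ = ψ
  ∃* (suc ℓ) ψ = ∃* ℓ (∃′ ψ)

  pairs : ∀ ℓ → List (Fin ℓ × Fin ℓ)
  pairs ℓ = List.filter (λ (i , j) → i <? j)
              (List.cartesianProduct (List.allFin ℓ) (List.allFin ℓ))

  -- ∃y₁ ⋯ ∃yₗ (⋀_{i<j} δ(yᵢ, yⱼ) ∧ ⋀_j ψ(yⱼ)) with l = suc ℓ.
  scattered : ℕ → Formula S 2 → Formula S 1 → Formula S 0
  scattered ℓ δ ψ = ∃* (suc ℓ) (List.foldr _∧′_ everywhere (List.map apart (pairs (suc ℓ))))
    where
    apart : Fin (suc ℓ) × Fin (suc ℓ) → Formula S (suc ℓ)
    apart (i , j) = rename (Vec.lookup (i ∷ j ∷ [])) δ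

    everywhere : Formula S (suc ℓ)
    everywhere = Vec.foldr₁ _∧′_ (Vec.tabulate (λ j → rename (λ _ → j) ψ))

  -- "dist(x, y) > 2r" may be any first-order formula expressing it.
  BasicLocalSentence : Formula S 0 → Set₁
  BasicLocalSentence χ =
    ∃[ ℓ ] ∃[ r ] ∃[ δ ] ∃[ ψ ]
      ExpressesDist> (2 * r) δ × LocalWithRadius r ψ × χ ≡ scattered ℓ δ ψ

  data BooleanCombination {n} (P : Formula S n → Set₁) : Formula S n → Set₁ where
    base : ∀ {ψ} → P ψ → BooleanCombination P ψ
    neg  : ∀ {ψ} → BooleanCombination P ψ → BooleanCombination P (¬′ ψ)
    conj : ∀ {ψ χ} → BooleanCombination P ψ → BooleanCombination P χ →
           BooleanCombination P (ψ ∧′ χ)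
    disj : ∀ {ψ χ} → BooleanCombination P ψ → BooleanCombination P χ →
           BooleanCombination P (ψ ∨′ χ)

  LocalOfRank≤ : ∀ {n} → ℕ → Formula S n → Set₁
  LocalOfRank≤ q ψ = Local ψ × qr ψ ≤ q

  -- A sentence χ regarded as a formula over n variables.
  IsBasicLocalSentence : ∀ {n} → Formula S n → Set₁
  IsBasicLocalSentence ψ = ∃[ χ ] (BasicLocalSentence χ × ψ ≡ rename (λ ()) χ)

data σ-Symbol : Set where
  E orange blue : σ-Symbol

σ : Signature
σ .Symbol       = σ-Symbol
σ .arity E      = 2
σ .arity orange = 1
σ .arity blue   = 1

φ : Formula σ 1
φ = ∃′ (rel orange (y ∷ [])
        ∧′ ¬′ ∃′ (rel E (x′ ∷ z ∷ []) ∧′ rel E (z ∷ y′ ∷ []))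
        ∧′ ¬′ ∃′ (rel blue (z ∷ []) ∧′ rel E (y′ ∷ z ∷ [])))
  where
  y : Fin 2
  y = zero
  z y′ x′ : Fin 3
  z  = zero
  y′ = suc zero
  x′ = suc (suc zero)

φ-rank : qr φ ≡ 2
φ-rank = refl

{-# OPTIONS --safe #-}
-- All vertices are orange, none is blue, and E is the reflexive closure of a
-- graph, so φ(x) says that some vertex has distance greater than 2 from x.  In
-- the theta graph consisting of two hubs joined by paths of lengths 2, 3 and 3,
-- a hub b violates φ and an inner vertex a of a path of length 3 satisfies it.
-- Sentences do not separate a and b, which live in the same structure.  A local
-- formula does not notice a disjoint edge added to the graph.  In the enlarged
-- graph, from a as well as from b, some vertex has distance ≥ 3.  Since the
-- theta graph has minimum degree 2 and no cycle of length less than 5, the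
-- distance class 0, 1, 2, ≥ 3 of a vertex from a or b determines which
-- adjacencies a third vertex can have to the two; hence the two-round
-- Ehrenfeucht–Fraïssé game does not separate a and b either.
module Submission where

open import Defs
open import Data.Bool using (Bool; true; false; _∧_; _∨_)
import Data.Bool.Properties as Bool
open import Data.Bool.ListAction using (any)
open import Data.Empty using (⊥-elim-irr)
open import Data.Fin using (Fin; zero; suc; lift)
open import Data.Fin.Patterns using (0F; 1F; 2F; 3F; 4F; 5F; 6F)
import Data.Fin.Properties as Fin
open import Data.Irrelevant as Irrelevant using ([_])
open import Data.List using (List; []; _∷_)
open import Data.Nat using (ℕ; zero; suc; _≤_; s≤s)
import Data.Nat.Properties as ℕ
open import Data.Product using (∃; ∃-syntax; _×_; _,_; proj₂)
open import Data.Product.Function.NonDependent.Propositional using (_×-⇔_)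
open import Data.Refinement using (value; _,_)
open import Data.Sum using (_⊎_; inj₁; inj₂)
open import Data.Sum.Function.Propositional using (_⊎-⇔_)
open import Data.Sum.Properties using (inj₁-injective)
open import Data.Vec as Vec using (Vec; []; _∷_)
open import Data.Vec.Functional as Vector using (Vector)
open import Data.Vec.Membership.Propositional.Properties using (∈-map⁺)
open import Data.Vec.Properties using (map-∘; map-cong)
open import Data.Vec.Relation.Unary.Any using (here; there)
open import Function using (_∘_; _⇔_; _↔_; mk⇔; Equivalence; Inverse)
open import Function.Definitions using (Injective)
open import Function.Properties.Inverse using (↔⇒↣; ↔-refl; ↔-sym)
open import Function.Properties.Equivalence using (⇔-isEquivalence)
open import Function.Related.TypeIsomorphisms using (¬-cong-⇔)
open import Level using (0ℓ)
open import Relation.Binary.Definitions using (DecidableEquality)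
open import Relation.Binary.PropositionalEquality
  using (_≡_; refl; sym; trans; cong; cong₂; subst)
open import Relation.Binary.Structures using (IsEquivalence)
open import Relation.Nullary using (¬_; Dec; does; contradiction)
open import Relation.Nullary.Decidable
  using (map′; from-yes; from-no; _×-dec_; _→-dec_; via-injection)
open import Relation.Unary using (Decidable)

open Equivalence using (to; from)

open IsEquivalence (⇔-isEquivalence {0ℓ}) using ()
  renaming (reflexive to ⇔-reflexive; sym to ⇔-sym; trans to infixr 4 _⟫_)

-- Satisfaction under renaming and Boolean combination.

module _ {S : Signature} where

  ⊨-rename : ∀ {m n} (A : Structure S) (ρ : Fin m → Fin n) (ψ : Formula S m) {α β} →
             (∀ i → α (ρ i) ≡ β i) → (A ⊨ rename ρ ψ [ α ]) ⇔ (A ⊨ ψ [ β ])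
  ⊨-rename A ρ (i ≐ j) e = ⇔-reflexive (cong₂ _≡_ (e i) (e j))
  ⊨-rename A ρ (rel R t) {α} e =
    ⇔-reflexive (cong (λ s → holds A R s ≡ true)
      (trans (sym (map-∘ α ρ t)) (map-cong e t)))
  ⊨-rename A ρ (¬′ ψ) e = ¬-cong-⇔ (⊨-rename A ρ ψ e)
  ⊨-rename A ρ (ψ ∧′ χ) e = ⊨-rename A ρ ψ e ×-⇔ ⊨-rename A ρ χ e
  ⊨-rename A ρ (ψ ∨′ χ) e = ⊨-rename A ρ ψ e ⊎-⇔ ⊨-rename A ρ χ e
  ⊨-rename A ρ (∃′ ψ) {α} {β} e =
    mk⇔ (λ (a , p) → a , to (body a) p) (λ (a , p) → a , from (body a) p)
    where
    body : ∀ a → _ ⇔ _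
    body a = ⊨-rename A (lift 1 ρ) ψ {a Vector.∷ α} {a Vector.∷ β}
               (λ { zero → refl ; (suc i) → e i })
  ⊨-rename A ρ (∀′ ψ) {α} {β} e =
    mk⇔ (λ p a → to (body a) (p a)) (λ p a → from (body a) (p a))
    where
    body : ∀ a → _ ⇔ _
    body a = ⊨-rename A (lift 1 ρ) ψ {a Vector.∷ α} {a Vector.∷ β}
               (λ { zero → refl ; (suc i) → e i })

  -- Both assignments restrict to the same empty assignment along `ρ`.
  sentence-invariant : ∀ {n} (A : Structure S) {ρ : Fin 0 → Fin n} (χ : Formula S 0) {ψ α β} →
                       ψ ≡ rename ρ χ → (A ⊨ ψ [ α ]) ⇔ (A ⊨ ψ [ β ])
  sentence-invariant A {ρ} χ refl =
    ⊨-rename A ρ χ {β = λ ()} (λ ()) ⟫ ⇔-sym (⊨-rename A ρ χ (λ ()))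

  combination-invariant : ∀ {n} {P : Formula S n → Set₁} (A : Structure S) {α β} →
    (∀ {ψ} → P ψ → (A ⊨ ψ [ α ]) ⇔ (A ⊨ ψ [ β ])) →
    ∀ {ψ} → BooleanCombination P ψ → (A ⊨ ψ [ α ]) ⇔ (A ⊨ ψ [ β ])
  combination-invariant A h (base p)   = h p
  combination-invariant A h (neg c)    = ¬-cong-⇔ (combination-invariant A h c)
  combination-invariant A h (conj c d) =
    combination-invariant A h c ×-⇔ combination-invariant A h d
  combination-invariant A h (disj c d) =
    combination-invariant A h c ⊎-⇔ combination-invariant A h d

  -- Ehrenfeucht-Fraïssé games and isomorphisms.

  module _ (A B : Structure S) where

    record PartialIso {n} (α : Vector (Universe A) n) (β : Vector (Universe B) n) : Set where
      constructor partialIso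
      field
        ≡-agree     : ∀ i j → (α i ≡ α j) ⇔ (β i ≡ β j)
        holds-agree : ∀ R t → holds A R (Vec.map α t) ≡ holds B R (Vec.map β t)

    EF : ∀ (q : ℕ) {n} → Vector (Universe A) n → Vector (Universe B) n → Set
    EF zero    α β = PartialIso α β
    EF (suc q) α β = PartialIso α β
      × (∀ a → ∃[ b ] EF q (a Vector.∷ α) (b Vector.∷ β))
      × (∀ b → ∃[ a ] EF q (a Vector.∷ α) (b Vector.∷ β))

  open PartialIso

  module _ {A B : Structure S} where

    EF⇒PartialIso : ∀ q {n} {α : Vector (Universe A) n} {β} → EF A B q α β → PartialIso A B α β
    EF⇒PartialIso zero    p       = p
    EF⇒PartialIso (suc q) (p , _) = p

    -- Each quantifier spends one round: `forth` carries a witness from `A` to `B` and `back`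
    -- carries one from `B` to `A`; for `∀′` the two swap roles.
    EF-sound : ∀ q {n} (ψ : Formula S n) {α β} → qr ψ ≤ q → EF A B q α β →
               (A ⊨ ψ [ α ]) ⇔ (B ⊨ ψ [ β ])
    EF-sound q (i ≐ j) _ p = ≡-agree (EF⇒PartialIso q p) i j
    EF-sound q (rel R t) _ p =
      ⇔-reflexive (cong (_≡ true) (holds-agree (EF⇒PartialIso q p) R t))
    EF-sound q (¬′ ψ) r p = ¬-cong-⇔ (EF-sound q ψ r p)
    EF-sound q (ψ ∧′ χ) r p =
      EF-sound q ψ (ℕ.m⊔n≤o⇒m≤o (qr ψ) (qr χ) r) p ×-⇔ EF-sound q χ (ℕ.m⊔n≤o⇒n≤o (qr ψ) (qr χ) r) p
    EF-sound q (ψ ∨′ χ) r p =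
      EF-sound q ψ (ℕ.m⊔n≤o⇒m≤o (qr ψ) (qr χ) r) p ⊎-⇔ EF-sound q χ (ℕ.m⊔n≤o⇒n≤o (qr ψ) (qr χ) r) p
    EF-sound (suc q) (∃′ ψ) (s≤s r) (_ , forth , back) = mk⇔
      (λ (a , s) → let (b , p) = forth a in b , to   (EF-sound q ψ r p) s)
      (λ (b , s) → let (a , p) = back  b in a , from (EF-sound q ψ r p) s)
    EF-sound (suc q) (∀′ ψ) (s≤s r) (_ , forth , back) = mk⇔
      (λ s b → let (a , p) = back  b in to   (EF-sound q ψ r p) (s a))
      (λ s a → let (b , p) = forth a in from (EF-sound q ψ r p) (s b))

    record IsIsomorphism (f : Universe A → Universe B) : Set where
      field
        injective : Injective _≡_ _≡_ f
        preimage  : ∀ b → ∃[ a ] f a ≡ b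
        preserves : ∀ R t → holds B R (Vec.map f t) ≡ holds A R t

    open IsIsomorphism

    iso⇒PartialIso : ∀ {f} → IsIsomorphism f → ∀ {n} {α : Vector (Universe A) n} {β} →
                     (∀ i → f (α i) ≡ β i) → PartialIso A B α β
    iso⇒PartialIso {f} iso {α = α} e .≡-agree i j = mk⇔
      (λ p → trans (sym (e i)) (trans (cong f p) (e j)))
      (λ p → injective iso (trans (e i) (trans p (sym (e j)))))
    iso⇒PartialIso {f} iso {α = α} e .holds-agree R t =
      trans (sym (preserves iso R (Vec.map α t)))
            (cong (holds B R) (trans (sym (map-∘ f α t)) (map-cong e t)))

    -- Duplicator answers by `f` in one direction and by preimages under `f` in the other, which
    -- works for any number of rounds.
    iso⇒EF : ∀ {f} → IsIsomorphism f → ∀ q {n} {α : Vector (Universe A) n} {β} →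
             (∀ i → f (α i) ≡ β i) → EF A B q α β
    iso⇒EF iso zero e = iso⇒PartialIso iso e
    iso⇒EF {f} iso (suc q) e = iso⇒PartialIso iso e ,
      (λ a → f a , iso⇒EF iso q λ { zero → refl ; (suc i) → e i }) ,
      (λ b → let (a , p) = preimage iso b in a , iso⇒EF iso q λ { zero → p ; (suc i) → e i })

    iso-invariant : ∀ {f} → IsIsomorphism f → ∀ {n} (ψ : Formula S n) {α β} →
                    (∀ i → f (α i) ≡ β i) → (A ⊨ ψ [ α ]) ⇔ (B ⊨ ψ [ β ])
    iso-invariant iso ψ e = EF-sound (qr ψ) ψ ℕ.≤-refl (iso⇒EF iso (qr ψ) e)

-- Disjoint unions of graphs and locality.

Graph : Set → Set
Graph V = V → V → Bool

structure : ∀ {V} → Graph V → Structure σ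
structure {V} G .Universe           = V
structure G .holds E (u ∷ v ∷ [])   = G u v
structure G .holds orange _         = true
structure G .holds blue _           = false

_⊕_ : ∀ {V W} → Graph V → Graph W → Graph (V ⊎ W)
(G ⊕ H) (inj₁ u) (inj₁ v) = G u v
(G ⊕ H) (inj₂ u) (inj₂ v) = H u v
(G ⊕ H) (inj₁ _) (inj₂ _) = false
(G ⊕ H) (inj₂ _) (inj₁ _) = false

module _ {V W : Set} (G : Graph V) (H : Graph W) where

  private
    𝔊 = structure G
    𝔊⊕ℌ = structure (G ⊕ H)

  holds-inj₁ : ∀ R t → holds 𝔊⊕ℌ R (Vec.map inj₁ t) ≡ holds 𝔊 R t
  holds-inj₁ E (u ∷ v ∷ []) = refl
  holds-inj₁ orange t = refl
  holds-inj₁ blue t = refl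

  GaifmanEdge-inj₁⁺ : ∀ {u v} → GaifmanEdge 𝔊 u v → GaifmanEdge 𝔊⊕ℌ (inj₁ u) (inj₁ v)
  GaifmanEdge-inj₁⁺ (u≢v , R , t , h , u∈t , v∈t) =
    u≢v ∘ inj₁-injective , R , Vec.map inj₁ t , trans (holds-inj₁ R t) h ,
    ∈-map⁺ inj₁ u∈t , ∈-map⁺ inj₁ v∈t

  -- No pair in `E` mixes the two summands, and a unary relation only relates an element to itself,
  -- which distinctness excludes.
  GaifmanEdge-inj₁⁻ : ∀ {u w} → GaifmanEdge 𝔊⊕ℌ (inj₁ u) w →
                      ∃[ v ] w ≡ inj₁ v × GaifmanEdge 𝔊 u v
  GaifmanEdge-inj₁⁻ (n , E , s ∷ t ∷ [] , h , here refl , here refl) = contradiction refl n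
  GaifmanEdge-inj₁⁻ (n , E , s ∷ inj₁ v ∷ [] , h , here refl , there (here refl)) =
    v , refl , n ∘ cong inj₁ , E , _ ∷ v ∷ [] , h , here refl , there (here refl)
  GaifmanEdge-inj₁⁻ (n , E , inj₁ v ∷ t ∷ [] , h , there (here refl) , here refl) =
    v , refl , n ∘ cong inj₁ , E , v ∷ _ ∷ [] , h , there (here refl) , here refl
  GaifmanEdge-inj₁⁻ (n , E , s ∷ t ∷ [] , h , there (here refl) , there (here refl)) =
    contradiction refl n
  GaifmanEdge-inj₁⁻ (n , orange , t ∷ [] , h , here refl , here refl) = contradiction refl n

  Dist≤-inj₁⁺ : ∀ {m u v} → Dist≤ 𝔊 m u v → Dist≤ 𝔊⊕ℌ m (inj₁ u) (inj₁ v)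
  Dist≤-inj₁⁺ stop       = stop
  Dist≤-inj₁⁺ (step e d) = step (GaifmanEdge-inj₁⁺ e) (Dist≤-inj₁⁺ d)

  Dist≤-inj₁⁻ : ∀ {m u w} → Dist≤ 𝔊⊕ℌ m (inj₁ u) w → ∃[ v ] w ≡ inj₁ v × Dist≤ 𝔊 m u v
  Dist≤-inj₁⁻ stop = _ , refl , stop
  Dist≤-inj₁⁻ (step e d) with GaifmanEdge-inj₁⁻ e
  ... | v , refl , e′ with Dist≤-inj₁⁻ d
  ...   | w , w≡ , d′ = w , w≡ , step e′ d′

  module _ {k} (r : ℕ) (ā : Vector V k) where

    InBall-inj₁⁻ : ∀ {v} → InBall 𝔊⊕ℌ r (inj₁ ∘ ā) (inj₁ v) → InBall 𝔊 r ā v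
    InBall-inj₁⁻ (i , d) with Dist≤-inj₁⁻ d
    ... | _ , refl , d′ = i , d′

    InBall-inj₂ : ∀ {w} → ¬ InBall 𝔊⊕ℌ r (inj₁ ∘ ā) (inj₂ w)
    InBall-inj₂ (i , d) with Dist≤-inj₁⁻ d
    ... | _ , () , _

    𝒩-inj₁ : Universe (𝒩 𝔊 r ā) → Universe (𝒩 𝔊⊕ℌ r (inj₁ ∘ ā))
    𝒩-inj₁ (v , p) = inj₁ v , Irrelevant.map (λ (i , d) → i , Dist≤-inj₁⁺ d) p

    𝒩-inj₁-iso : IsIsomorphism {A = 𝒩 𝔊 r ā} {B = 𝒩 𝔊⊕ℌ r (inj₁ ∘ ā)} 𝒩-inj₁
    𝒩-inj₁-iso = record
      { injective = λ { refl → refl }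
      ; preimage  = λ { (inj₁ v , [ p ]) → (v , [ InBall-inj₁⁻ p ]) , refl
                      -- A ball around vertices of the left summand never reaches the right one; as
                      -- `p` is irrelevant, the contradiction must be eliminated irrelevantly.
                      ; (inj₂ w , [ p ]) → ⊥-elim-irr (InBall-inj₂ p) }
      ; preserves = λ R t → trans
          (cong (holds 𝔊⊕ℌ R) (trans (sym (map-∘ value 𝒩-inj₁ t)) (map-∘ inj₁ value t)))
          (holds-inj₁ R (Vec.map value t))
      }

  -- The tuple witnessing locality may be longer than (x); it is instantiated
  -- with copies of v, whose neighbourhood is that of v.
  local-⊕ : Finite 𝔊 → Finite 𝔊⊕ℌ → ∀ {n} {ψ : Formula σ n} → Local ψ → ∀ v →
            (𝔊 ⊨ ψ [ (λ _ → v) ]) ⇔ (𝔊⊕ℌ ⊨ ψ [ (λ _ → inj₁ v) ])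
  local-⊕ fin fin′ {ψ = ψ} (r , k , ρ , _ , loc) v =
    loc 𝔊 fin (λ _ → v)
      ⟫ iso-invariant (𝒩-inj₁-iso r (λ _ → v)) ψ (λ _ → refl)
      ⟫ ⇔-sym (loc 𝔊⊕ℌ fin′ (λ _ → inj₁ v))

-- Deciding the game on a finite graph.

module _ {V : Set} {n} (f : V ↔ Fin n) where

  ∃? : ∀ {P : V → Set} → Decidable P → Dec (∃ P)
  ∃? {P} P? = map′ (λ (i , p) → Inverse.from f i , p)
                   (λ (v , p) → Inverse.to f v , subst P (sym (Inverse.strictlyInverseʳ f v)) p)
                   (Fin.any? (P? ∘ Inverse.from f))

  ∀? : ∀ {P : V → Set} → Decidable P → Dec (∀ v → P v)
  ∀? {P} P? = map′ (λ p v → subst P (Inverse.strictlyInverseʳ f v) (p (Inverse.to f v)))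
                   (λ p → p ∘ Inverse.from f)
                   (Fin.all? (P? ∘ Inverse.from f))

  finite-≟ : DecidableEquality V
  finite-≟ = via-injection (↔⇒↣ f) Fin._≟_

module _ {V : Set} {n} (f : V ↔ Fin n) (G : Graph V) where

  -- Checking pairs of indices suffices: `E` is binary, and the two colours are constant on
  -- `structure G`.
  PartialIso? : ∀ {m} (α β : Vector V m) → Dec (PartialIso (structure G) (structure G) α β)
  PartialIso? {m} α β = map′
    (λ (p : ∀ i j → Agree i j) → partialIso
      (λ i j → let (g , h , _) = p i j in mk⇔ g h)
      (λ { E (i ∷ j ∷ []) → proj₂ (proj₂ (p i j)) ; orange (_ ∷ []) → refl ; blue (_ ∷ []) → refl }))
    (λ p i j → to (≡-agree p i j) , from (≡-agree p i j) , holds-agree p E (i ∷ j ∷ []))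
    (Fin.all? λ i → Fin.all? λ j →
      (α i ≟ α j →-dec β i ≟ β j) ×-dec (β i ≟ β j →-dec α i ≟ α j)
        ×-dec (G (α i) (α j) Bool.≟ G (β i) (β j)))
    where
    open PartialIso
    _≟_ = finite-≟ f
    Agree : Fin m → Fin m → Set
    Agree i j = (α i ≡ α j → β i ≡ β j) × (β i ≡ β j → α i ≡ α j)
      × G (α i) (α j) ≡ G (β i) (β j)

  EF? : ∀ q {m} (α β : Vector V m) → Dec (EF (structure G) (structure G) q α β)
  EF? zero    α β = PartialIso? α β
  EF? (suc q) α β = PartialIso? α β
    ×-dec ∀? f (λ u → ∃? f (λ v → EF? q (u Vector.∷ α) (v Vector.∷ β)))
    ×-dec ∀? f (λ v → ∃? f (λ u → EF? q (u Vector.∷ α) (v Vector.∷ β)))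

-- The theta graph and its enlargement.

reflexiveGraph : ∀ {n} → List (Fin n × Fin n) → Graph (Fin n)
reflexiveGraph es u v = (u == v) ∨ any (λ (s , t) → (u == s ∧ v == t) ∨ (u == t ∧ v == s)) es
  where
  infix 7 _==_
  _==_ : ∀ {n} → Fin n → Fin n → Bool
  s == t = does (s Fin.≟ t)

-- The hubs are `0F` and `1F`; each row lists one of the three paths between them.
θ : Graph (Fin 7)
θ = reflexiveGraph
  ( (0F , 2F) ∷ (2F , 1F)
  ∷ (0F , 3F) ∷ (3F , 4F) ∷ (4F , 1F)
  ∷ (0F , 5F) ∷ (5F , 6F) ∷ (6F , 1F)
  ∷ [])

-- An isolated vertex would not do: if Spoiler plays `6F` against `a`, Duplicator must answer
-- outside `θ`, and a second move to a proper neighbour of `6F` then calls for a proper neighbour of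
-- that answer.
K₂ : Graph (Fin 2)
K₂ _ _ = true

a b : Fin 7
a = 3F
b = 0F

θ-finite : Finite (structure θ)
θ-finite = 6 , ↔-refl

θ⊕K₂-finite : Finite (structure (θ ⊕ K₂))
-- `Finite` adds one to its number, so 8 stands for the 7 + 2 vertices.
θ⊕K₂-finite = 8 , ↔-sym (Fin.+↔⊎ {7} {2})

φ-at-a : structure θ ⊨ φ [ (λ _ → a) ]
-- `6F` is the only vertex at distance greater than 2 from `a`.
φ-at-a = 6F , refl
       , from-no (Fin.any? λ z → (θ a z Bool.≟ true) ×-dec (θ z 6F Bool.≟ true))
       , λ { (_ , () , _) }

¬φ-at-b : ¬ (structure θ ⊨ φ [ (λ _ → b) ])
-- Since `E` is reflexive, one intermediate `z` also covers distances 0 and 1.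
¬φ-at-b (y , _ , far , _) = far (from-yes
  (Fin.all? λ y → Fin.any? λ z → (θ b z Bool.≟ true) ×-dec (θ z y Bool.≟ true)) y)

-- Two rounds on nine vertices are a finite search, settled by evaluation.
a-EF-b : EF (structure (θ ⊕ K₂)) (structure (θ ⊕ K₂)) 2 {1} (λ _ → inj₁ a) (λ _ → inj₁ b)
a-EF-b = from-yes
  (EF? (proj₂ θ⊕K₂-finite) (θ ⊕ K₂) 2 {1} (λ _ → inj₁ a) (λ _ → inj₁ b))

claim19 : ¬ (∃[ φ′ ] (BooleanCombination (λ ψ → LocalOfRank≤ 2 ψ ⊎ IsBasicLocalSentence ψ) φ′
    × φ ≋ φ′))
claim19 (φ′ , combination , equiv) = ¬φ-at-b (from (equiv _ θ-finite _)
  (to (combination-invariant (structure θ) agree combination)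
    (to (equiv _ θ-finite _) φ-at-a)))
  where
  agree : ∀ {ψ} → LocalOfRank≤ 2 ψ ⊎ IsBasicLocalSentence ψ →
          (structure θ ⊨ ψ [ (λ _ → a) ]) ⇔ (structure θ ⊨ ψ [ (λ _ → b) ])
  agree {ψ} (inj₁ (local , rank)) =
    -- Duplicator wins only in the enlarged graph, so the formula is moved there at `a` and back at
    -- `b`.
    local-⊕ θ K₂ θ-finite θ⊕K₂-finite local a
      ⟫ EF-sound 2 ψ rank a-EF-b
      ⟫ ⇔-sym (local-⊕ θ K₂ θ-finite θ⊕K₂-finite local b)
  agree (inj₂ (χ , _ , ψ≡χ)) = sentence-invariant (structure θ) χ ψ≡χ
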